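{- For every integer $n\ge1$, the Narayana polynomials satisfy \[C_n(q)=(1-q)^{n-1}+q\sum_{k=1}^{n-1}C_{n-k}(q)\sum_{m=0}^{k-1}(-1)^m\binom{k-1}{m}\binom{n-m}{k}(1-q)^{k-m-1}.\]
   Context: $q$ is an indeterminate. The Narayana polynomials are $C_0(q)=1$ and $C_n(q)=\sum_{k=1}^n \frac1n\binom{n}{k-1}\binom{n}{k}q^{k-1}$ for $n\ge1$. -}

module Defs where

open import Data.Nat as ℕ using (ℕ; zero; suc; _∸_)
open import Data.Nat.DivMod using (_/_)
open import Data.Nat.Combinatorics using (_C_)
open import Data.Integer as ℤ using (ℤ; +_; -_)
open import Relation.Binary.PropositionalEquality using (_≡_)

-- Polynomials in the indeterminate q with integer coefficients, represented
-- by their coefficient sequence: p i is the coefficient of q^i.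
-- Two polynomials are equal iff all coefficients agree (see _≈ₚ_ below).
Poly : Set
Poly = ℕ → ℤ

cst : ℤ → Poly
cst c zero    = c
cst c (suc _) = + 0

qP : Poly
qP 1 = + 1
qP _ = + 0

infixl 6 _⊕_ _⊖_
infixl 7 _⊗_
infixr 8 _^ₚ_

_⊕_ : Poly → Poly → Poly
(p ⊕ r) i = p i ℤ.+ r i

negP : Poly → Poly
negP p i = ℤ.- p i

_⊖_ : Poly → Poly → Poly
p ⊖ r = p ⊕ negP r

_⊗_ : Poly → Poly → Poly
(p ⊗ r) i = go (suc i)
  where
  go : ℕ → ℤ
  go zero    = + 0
  go (suc j) = go j ℤ.+ p j ℤ.* r (i ∸ j)

_^ₚ_ : Poly → ℕ → Poly
p ^ₚ zero  = cst (+ 1)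
p ^ₚ suc n = p ⊗ (p ^ₚ n)

-- ∑[ lo , hi ] f = f lo + f (lo+1) + ... + f hi   (zero polynomial if hi < lo)
∑ : ℕ → ℕ → (ℕ → Poly) → Poly
∑ lo hi f = go (suc hi ∸ lo)
  where
  go : ℕ → Poly
  go zero    = cst (+ 0)
  go (suc j) = go j ⊕ f (lo ℕ.+ j)

infix 4 _≈ₚ_
_≈ₚ_ : Poly → Poly → Set
p ≈ₚ r = ∀ i → p i ≡ r i

-- Narayana polynomials: C₀(q) = 1 and, for n ≥ 1,
-- C_n(q) = Σ_{k=1}^{n} (1/n) binom(n,k-1) binom(n,k) q^{k-1}.
-- The coefficient of q^i (i.e. k = i+1) is binom(n,i) binom(n,i+1) / n,
-- which is an exact division (Narayana numbers are integers); for i ≥ n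
-- it is 0 since binom(n,i+1) = 0.
Narayana : ℕ → Poly
Narayana zero          = cst (+ 1)
Narayana (suc m) i     = + (((suc m C i) ℕ.* (suc m C suc i)) / suc m)

{-# OPTIONS --safe #-}

-- Put p = 1 - q and let F = Σ_{n ≥ 1} Cₙ zⁿ, so that F = z (1 + F) (1 + q F).
-- The inner sum of the theorem is A = [x^j] (p - x)^(k-1) / (1 - x)^(k+1) with
-- j = n - k, and for j, k ≥ 1 partial fractions give
-- -q A = [tᵏ] ((1 - t) / (1 - p t))^(j+1). The theorem thus states that
-- Σ_j C_j t^j ((1 - t) / (1 - p t))^(j+1) = t / (1 - p t), that is, F takes the
-- value t / (1 - t) at z = t (1 - t) / (1 - p t). This is proved for all powers
-- Fʳ at once: their coefficients satisfy a linear recurrence in (n , r), which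
-- the substitution turns into one that determines the result and is solved by
-- the powers of t / (1 - t). The coefficients of F itself are identified with
-- the Narayana numbers through a 2 × 2 determinant of binomial coefficients.
module Submission where

open import Defs
open import Algebra.Bundles using (CommutativeRing)
open import Algebra.Solver.Ring.AlmostCommutativeRing
  using (fromCommutativeRing; -raw-almostCommutative⟶; _-Raw-AlmostCommutative⟶_; Induced-equivalence)
open import Data.Integer as ℤ using (ℤ; +_; -[1+_]; -_; _^_) renaming (_*_ to _*ℤ_)
import Data.Integer.Properties as ℤₚ
import Data.Integer.Solver as ℤ-Solver
open import Data.Maybe.Base using (just; nothing)
open import Data.Nat as ℕ using (ℕ; zero; suc; _≤_; z≤n; s≤s; _∸_; _+_)
open import Data.Nat.Combinatorics using (_C_; nCk+nC[k+1]≡[n+1]C[k+1]; k>n⇒nCk≡0)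
open import Data.Nat.DivMod using (_/_; m*n/n≡m)
import Data.Nat.Properties as ℕₚ
open import Data.Product.Base using (_,_)
open import Function.Base using (_∘_)
open import Level using (Level; 0ℓ)
open import Relation.Binary.Definitions using (WeaklyDecidable)
open import Relation.Binary.PropositionalEquality as ≡ using (_≡_)
open import Relation.Nullary.Decidable using (yes; no)

-- The module is instantiated twice: at the integers, where antidiagonal sums serve to prove that
-- polynomials form a ring, and then at that ring. The homomorphism carries binomial coefficients
-- into `R` and supplies the coefficients of the ring solver.
module RingWithIntegers {c ℓ : Level} (R : CommutativeRing c ℓ)
  (hom : CommutativeRing.rawRing ℤₚ.+-*-commutativeRing
           -Raw-AlmostCommutative⟶ fromCommutativeRing R) where

  open CommutativeRing R hiding (zero) renaming (_+_ to _+ᴿ_; -_ to -ᴿ_; _-_ to _-ᴿ_)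
  open _-Raw-AlmostCommutative⟶_ hom renaming (⟦_⟧ to ι)
  open import Algebra.Properties.Ring ring using (-‿distribˡ-*; -0#≈0#)
  open import Relation.Binary.Reasoning.Setoid setoid

  private
    _ι≟_ : WeaklyDecidable (Induced-equivalence hom)
    x ι≟ y with x ℤₚ.≟ y
    ... | yes x≡y = just (reflexive (≡.cong ι x≡y))
    ... | no _    = nothing

  open import Algebra.Solver.Ring (CommutativeRing.rawRing ℤₚ.+-*-commutativeRing)
    (fromCommutativeRing R) hom _ι≟_ using (solve; _:=_; _:+_; _:*_; _:-_; :-_)

  -- Sums over antidiagonals.

  -- anti f n sums f i j over the antidiagonal i + j = n.
  anti : (ℕ → ℕ → Carrier) → ℕ → Carrier
  anti f zero    = f 0 0
  anti f (suc n) = f (suc n) 0 +ᴿ anti (λ i j → f i (suc j)) n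

  anti-cong : ∀ {f g} n → (∀ i j → i + j ≡ n → f i j ≈ g i j) → anti f n ≈ anti g n
  anti-cong zero    f≈g = f≈g 0 0 ≡.refl
  anti-cong (suc n) f≈g = +-cong (f≈g (suc n) 0 (ℕₚ.+-identityʳ (suc n)))
    (anti-cong n λ i j i+j≡n → f≈g i (suc j) (≡.trans (ℕₚ.+-suc i j) (≡.cong suc i+j≡n)))

  anti-sucˡ : ∀ f n → anti f (suc n) ≈ f 0 (suc n) +ᴿ anti (λ i j → f (suc i) j) n
  anti-sucˡ f zero    = +-comm (f 1 0) (f 0 1)
  anti-sucˡ f (suc n) = trans (+-congˡ (anti-sucˡ (λ i j → f i (suc j)) n))
    (solve 3 (λ x y z → x :+ (y :+ z) := y :+ (x :+ z)) refl _ _ _)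

  anti-swap : ∀ f n → anti f n ≈ anti (λ i j → f j i) n
  anti-swap f zero    = refl
  anti-swap f (suc n) = trans (+-congˡ (anti-swap (λ i j → f i (suc j)) n))
    (sym (anti-sucˡ (λ i j → f j i) n))

  anti-+ : ∀ f g n → anti (λ i j → f i j +ᴿ g i j) n ≈ anti f n +ᴿ anti g n
  anti-+ f g zero    = refl
  anti-+ f g (suc n) = trans (+-congˡ (anti-+ (λ i j → f i (suc j)) (λ i j → g i (suc j)) n))
    (solve 4 (λ x y z w → (x :+ y) :+ (z :+ w) := (x :+ z) :+ (y :+ w)) refl _ _ _ _)

  anti-* : ∀ x f n → anti (λ i j → x * f i j) n ≈ x * anti f n
  anti-* x f zero    = refl
  anti-* x f (suc n) = trans (+-congˡ (anti-* x (λ i j → f i (suc j)) n)) (sym (distribˡ x _ _))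

  anti-neg : ∀ f n → anti (λ i j → -ᴿ f i j) n ≈ -ᴿ anti f n
  anti-neg f zero    = refl
  anti-neg f (suc n) = trans (+-congˡ (anti-neg (λ i j → f i (suc j)) n))
    (solve 2 (λ x y → :- x :+ :- y := :- (x :+ y)) refl _ _)

  anti-0 : ∀ n → anti (λ _ _ → 0#) n ≈ 0#
  anti-0 zero    = refl
  anti-0 (suc n) = trans (+-identityˡ _) (anti-0 n)

  -- Forward differences at 0 and alternating binomial sums.

  Δ : ℕ → (ℕ → Carrier) → Carrier
  Δ zero    h = h 0
  Δ (suc d) h = Δ d (h ∘ suc) -ᴿ Δ d h

  Δ-cong : ∀ {h k} d → (∀ i → i ≤ d → h i ≈ k i) → Δ d h ≈ Δ d k
  Δ-cong zero    h≈k = h≈k 0 z≤n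
  Δ-cong (suc d) h≈k = +-cong (Δ-cong d λ i i≤d → h≈k (suc i) (s≤s i≤d))
    (-‿cong (Δ-cong d λ i i≤d → h≈k i (ℕₚ.m≤n⇒m≤1+n i≤d)))

  Δ-0 : ∀ d → Δ d (λ _ → 0#) ≈ 0#
  Δ-0 zero    = refl
  Δ-0 (suc d) = -‿inverseʳ _

  Δ-+ : ∀ h k d → Δ d (λ i → h i +ᴿ k i) ≈ Δ d h +ᴿ Δ d k
  Δ-+ h k zero    = refl
  Δ-+ h k (suc d) = trans (+-cong (Δ-+ (h ∘ suc) (k ∘ suc) d) (-‿cong (Δ-+ h k d)))
    (solve 4 (λ x y z w → (x :+ y) :- (z :+ w) := (x :- z) :+ (y :- w)) refl _ _ _ _)

  Δ-* : ∀ x h d → Δ d (λ i → x * h i) ≈ x * Δ d h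
  Δ-* x h zero    = refl
  Δ-* x h (suc d) = trans (+-cong (Δ-* x (h ∘ suc) d) (-‿cong (Δ-* x h d)))
    (solve 3 (λ x y z → x :* y :- x :* z := x :* (y :- z)) refl _ _ _)

  sgn : ℕ → ℤ
  sgn m = (- (+ 1)) ^ m

  -- Induction on `d`: Pascal's rule with the alternating sign splits row `d + 1` into two copies of
  -- row `d`, one applied to `h ∘ suc` and one subtracted.
  Δ-binomial : ∀ h d → anti (λ i m → ι (sgn m *ℤ + (d C m)) * h i) d ≈ Δ d h
  Δ-binomial h zero    = trans (*-congʳ 1-homo) (*-identityˡ (h 0))
  Δ-binomial h (suc d) = begin
    anti (term (suc d)) (suc d)
      ≈⟨ +-congˡ (trans (anti-cong d λ i m _ → pascal i m) (anti-+ _ _ d)) ⟩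
    term (suc d) (suc d) 0 +ᴿ (anti (λ i m → term d i (suc m)) d +ᴿ anti (λ i m → -ᴿ term d i m) d)
      -- A binomial coefficient with lower index 0 is 1 in either row, so the separate `m = 0` term
      -- completes the first sum to `anti (term d) (suc d)`. Its opposite end, `i = 0`, has lower
      -- index `d + 1` and vanishes.
      ≈⟨ trans (sym (+-assoc _ _ _)) (+-congˡ (anti-neg (term d) d)) ⟩
    anti (term d) (suc d) -ᴿ anti (term d) d
      ≈⟨ +-congʳ (anti-sucˡ (term d) d) ⟩
    term d 0 (suc d) +ᴿ anti (λ i m → term d (suc i) m) d -ᴿ anti (term d) d
      ≈⟨ +-congʳ (trans (+-congʳ last-zero) (+-identityˡ _)) ⟩
    anti (λ i m → term d (suc i) m) d -ᴿ anti (term d) d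
      ≈⟨ +-cong (Δ-binomial (h ∘ suc) d) (-‿cong (Δ-binomial h d)) ⟩
    Δ (suc d) h ∎
    where
    term : ℕ → ℕ → ℕ → Carrier
    term d i m = ι (sgn m *ℤ + (d C m)) * h i

    last-zero : term d 0 (suc d) ≈ 0#
    last-zero = trans (*-congʳ (trans (reflexive (≡.cong ι (≡.trans
      (≡.cong (λ x → sgn (suc d) *ℤ + x) (k>n⇒nCk≡0 (ℕₚ.n<1+n d))) (ℤₚ.*-zeroʳ (sgn (suc d))))))
      0-homo)) (zeroˡ _)

    split : ∀ m → sgn (suc m) *ℤ + (suc d C suc m) ≡
      sgn (suc m) *ℤ + (d C suc m) ℤ.+ - (sgn m *ℤ + (d C m))
    split m = ≡.trans (≡.cong (λ x → sgn (suc m) *ℤ + x) (≡.sym (nCk+nC[k+1]≡[n+1]C[k+1] d m)))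
      (solveℤ 3 (λ s x y → (-1ℤ ⊛ s) ⊛ (x ⊞ y) ⊜ (-1ℤ ⊛ s) ⊛ y ⊞ ⊟ (s ⊛ x))
        ≡.refl (sgn m) (+ (d C m)) (+ (d C suc m)))
      where
      open ℤ-Solver.+-*-Solver using (con; Polynomial)
        renaming (solve to solveℤ; _:+_ to _⊞_; _:*_ to _⊛_; :-_ to ⊟_; _:=_ to _⊜_)
      -1ℤ : Polynomial 3
      -1ℤ = con (- (+ 1))

    pascal : ∀ i m → term (suc d) i (suc m) ≈ term d i (suc m) +ᴿ -ᴿ term d i m
    pascal i m = trans (*-congʳ (trans (reflexive (≡.cong ι (split m)))
      (trans (+-homo _ _) (+-congˡ (-‿homo _)))))
      (solve 3 (λ x y z → (x :+ :- y) :* z := x :* z :+ :- (y :* z)) refl _ _ _)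

  infixr 9 _^ᴿ_
  _^ᴿ_ : Carrier → ℕ → Carrier
  x ^ᴿ zero  = 1#
  x ^ᴿ suc n = x * x ^ᴿ n

  -- Coefficient arrays of the substitution z = t (1 - t) / (1 - p t).

  module Inversion (q : Carrier) where

    p : Carrier
    p = 1# -ᴿ q

    p* : ∀ x → p * x ≈ x -ᴿ q * x
    p* x = trans (distribʳ x 1# (-ᴿ q)) (+-cong (*-identityˡ x) (sym (-‿distribˡ-* q x)))

    -- B n r is the coefficient of zⁿ in Fʳ, where F = Σ_{n ≥ 1} Cₙ zⁿ solves
    -- F = z (1 + F) (1 + q F).
    B : ℕ → ℕ → Carrier
    B zero    zero    = 1#
    B zero    (suc r) = 0#
    B (suc n) zero    = 0#
    B (suc n) (suc r) = B n r +ᴿ (B n (suc r) +ᴿ q * B n (suc r)) +ᴿ q * B n (suc (suc r))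

    -- V e d is the coefficient of t^d in ((1 - t) / (1 - p t))^e.
    V : ℕ → ℕ → Carrier
    V _       zero    = 1#
    V zero    (suc d) = 0#
    V (suc e) (suc d) = p * V (suc e) d +ᴿ V e (suc d) -ᴿ V e d

    -- E n r is the coefficient of tⁿ in tʳ (1 - t)¹⁻ʳ / (1 - p t).
    E : ℕ → ℕ → Carrier
    E zero    zero    = 1#
    E (suc n) zero    = p ^ᴿ suc n -ᴿ p ^ᴿ n
    E zero    (suc r) = 0#
    E (suc n) (suc r) = E n (suc r) +ᴿ E n r

    -- H n r is the coefficient of tⁿ in
    -- ((1 - t) / (1 - p t)) F(t (1 - t) / (1 - p t))ʳ.
    H : ℕ → ℕ → Carrier
    H n r = anti (λ j d → B j r * V (suc j) d) n

    -- Multiplication by (1 + F) (1 + q F) on an array of coefficients of powers of F. The last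
    -- clause of `B` is `B (suc n) (suc r) = K B n r`; abstracting the array lets the same operator
    -- act on `E` and `H`.
    K : (ℕ → ℕ → Carrier) → ℕ → ℕ → Carrier
    K f n r = f n r +ᴿ (f n (suc r) +ᴿ q * f n (suc r)) +ᴿ q * f n (suc (suc r))

    K-cong : ∀ f g n r → (∀ r → f n r ≈ g n r) → K f n r ≈ K g n r
    K-cong f g n r f≈g = +-cong (+-cong (f≈g r) (+-cong (f≈g (suc r)) (*-congˡ (f≈g (suc r)))))
      (*-congˡ (f≈g (suc (suc r))))

    -- For `r = 1` the powers of 1 - t cancel and t / (1 - p t) remains.
    E-one : ∀ n → E (suc n) 1 ≈ p ^ᴿ n
    E-one zero    = +-identityˡ 1#
    E-one (suc n) = trans (+-congʳ (E-one n))
      (solve 2 (λ x y → x :+ (y :- x) := y) refl _ _)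

    E-1 : ∀ r → E 1 (suc r) ≈ K E 0 r
    E-1 r = begin
      0# +ᴿ E 0 r
        ≈⟨ solve 2 (λ z x → z :+ x := x :+ z) refl _ _ ⟩
      E 0 r +ᴿ 0#
        ≈⟨ sym (+-congˡ (trans (+-congˡ (zeroʳ q)) (+-identityʳ 0#))) ⟩
      E 0 r +ᴿ (0# +ᴿ q * 0#)
        ≈⟨ sym (trans (+-congˡ (zeroʳ q)) (+-identityʳ _)) ⟩
      K E 0 r ∎

    -- For u = t / (1 - t) one has 1 + u = 1 / (1 - t) and 1 + q u = (1 - p t) / (1 - t), hence (1 -
    -- p t) u = t (1 - t) (1 + u) (1 + q u). The recurrence compares coefficients after
    -- multiplication by uʳ (1 - t) / (1 - p t).
    E-rec : ∀ n r → E (suc (suc n)) (suc r) ≈ p * E (suc n) (suc r) +ᴿ (K E (suc n) r -ᴿ K E n r)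
    E-rec n r = trans
      -- The defining clauses of `E` reduce every entry to these four, and `p*` has removed `p`, so
      -- a polynomial identity remains.
      (solve 5 (λ q er en eR e₊ → let x = eR :+ er in
         x :+ en := (x :- q :* x) :+ ((en :+ (x :+ q :* x) :+ q :* (e₊ :+ eR))
           :- (er :+ (eR :+ q :* eR) :+ q :* e₊)))
         refl q (E n r) (E (suc n) r) (E n (suc r)) (E n (suc (suc r))))
      (+-congʳ (sym (p* (E (suc n) (suc r)))))

    -- `B (suc j) (suc r)` is `K B j r`, and `K` is linear and acts on the second index of `B` only,
    -- so it passes through the sum. The exponent of `V` stays `suc j` although the first index of
    -- `B` moves.
    H-K : ∀ n r → anti (λ j d → B (suc j) (suc r) * V (suc j) d) n ≈ K H n r
    H-K n r = begin
      anti (λ j d → B (suc j) (suc r) * V (suc j) d) n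
        ≈⟨ anti-cong n (λ j d _ → solve 5 (λ q x y z v → (x :+ (y :+ q :* y) :+ q :* z) :* v
             := (x :* v :+ (y :* v :+ q :* (y :* v))) :+ q :* (z :* v)) refl q
             (B j r) (B j (suc r)) (B j (suc (suc r))) (V (suc j) d)) ⟩
      anti (λ j d → (h r j d +ᴿ (h (suc r) j d +ᴿ q * h (suc r) j d)) +ᴿ q * h (suc (suc r)) j d) n
        ≈⟨ trans (anti-+ _ _ n) (+-cong
             (trans (anti-+ _ _ n) (+-congˡ (trans (anti-+ _ _ n) (+-congˡ (anti-* q _ n)))))
             (anti-* q _ n)) ⟩
      K H n r ∎
      where
      h : ℕ → ℕ → ℕ → Carrier
      h r j d = B j r * V (suc j) d

    H-suc : ∀ n r → H (suc n) (suc r) ≈ anti (λ j d → B (suc j) (suc r) * V (suc (suc j)) d) n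
    H-suc n r = trans (anti-sucˡ (λ j d → B j (suc r) * V (suc j) d) n)
      (trans (+-congʳ (zeroˡ _)) (+-identityˡ _))

    -- The recurrence of `V` expresses (1 - p t) Wᵉ⁺¹ = (1 - t) Wᵉ for W = (1 - t) / (1 - p t). It
    -- lowers the exponent in `H-suc` to the one required by `H-K`.
    H-rec : ∀ n r → H (suc (suc n)) (suc r) ≈ p * H (suc n) (suc r) +ᴿ (K H (suc n) r -ᴿ K H n r)
    H-rec n r = begin
      H (suc (suc n)) (suc r)
        ≈⟨ H-suc (suc n) r ⟩
      b (suc n) * 1# +ᴿ anti (λ j d → b j * (p * V (suc (suc j)) d +ᴿ V (suc j) (suc d) -ᴿ V (suc j) d)) n
        ≈⟨ +-congˡ (trans (anti-cong n λ j d _ →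
             solve 5 (λ b p x y z → b :* (p :* x :+ y :- z) := p :* (b :* x) :+ (b :* y :+ :- (b :* z)))
               refl (b j) p _ _ _)
             (trans (anti-+ _ _ n) (+-cong (anti-* p _ n) (trans (anti-+ _ _ n) (+-congˡ (anti-neg _ n)))))) ⟩
      b (suc n) * 1# +ᴿ (p * anti (λ j d → b j * V (suc (suc j)) d) n
        +ᴿ (anti (λ j d → b j * V (suc j) (suc d)) n -ᴿ anti (λ j d → b j * V (suc j) d) n))
        -- The summand `b (suc n) * 1#`, split off because the recurrence of `V` does not reach
        -- `d = 0`, is the missing `d = 0` term of the sum with `V (suc j) (suc d)`.
        ≈⟨ solve 4 (λ x y z w → x :+ (y :+ (z :- w)) := y :+ ((x :+ z) :- w)) refl _ _ _ _ ⟩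
      p * anti (λ j d → b j * V (suc (suc j)) d) n
        +ᴿ (anti (λ j d → b j * V (suc j) d) (suc n) -ᴿ anti (λ j d → b j * V (suc j) d) n)
        ≈⟨ +-cong (*-congˡ (sym (H-suc n r))) (+-cong (H-K (suc n) r) (-‿cong (H-K n r))) ⟩
      p * H (suc n) (suc r) +ᴿ (K H (suc n) r -ᴿ K H n r) ∎
      where
      b : ℕ → Carrier
      b j = B (suc j) (suc r)

    V-1 : ∀ n → V 1 (suc n) ≈ p ^ᴿ suc n -ᴿ p ^ᴿ n
    V-1 zero    = +-congʳ (+-identityʳ _)
    V-1 (suc n) = trans (+-congʳ (+-congʳ (*-congˡ (V-1 n))))
      (solve 4 (λ p x y z → p :* (x :- y) :+ z :- z := p :* x :- p :* y) refl p _ _ 0#)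

    -- The common recurrence gives an entry of row `n + 2` from its left neighbours in rows `n + 1`
    -- and `n` and from higher columns of those rows, so the induction is on rows with all `r` at
    -- once. Row 1 needs its own case, since the recurrence reaches two rows back.
    H≈E : ∀ n r → H n r ≈ E n r
    H≈E zero    zero    = *-identityˡ 1#
    H≈E zero    (suc r) = zeroˡ 1#
    H≈E (suc n) zero    = begin
      H (suc n) 0
        ≈⟨ anti-sucˡ (λ j d → B j 0 * V (suc j) d) n ⟩
      1# * V 1 (suc n) +ᴿ anti (λ j d → 0# * V (suc (suc j)) d) n
        ≈⟨ +-cong (*-identityˡ _) (trans (anti-* 0# _ n) (zeroˡ _)) ⟩
      V 1 (suc n) +ᴿ 0#
        ≈⟨ trans (+-identityʳ _) (V-1 n) ⟩
      E (suc n) 0 ∎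
    H≈E (suc zero) (suc r) = trans (H-suc 0 r)
      (trans (H-K 0 r) (trans (K-cong H E 0 r (H≈E 0)) (sym (E-1 r))))
    H≈E (suc (suc n)) (suc r) = begin
      H (suc (suc n)) (suc r)
        ≈⟨ H-rec n r ⟩
      p * H (suc n) (suc r) +ᴿ (K H (suc n) r -ᴿ K H n r)
        ≈⟨ +-cong (*-congˡ (H≈E (suc n) (suc r)))
             (+-cong (K-cong H E (suc n) r (H≈E (suc n))) (-‿cong (K-cong H E n r (H≈E n)))) ⟩
      p * E (suc n) (suc r) +ᴿ (K E (suc n) r -ᴿ K E n r)
        ≈⟨ sym (E-rec n r) ⟩
      E (suc (suc n)) (suc r) ∎

    -- The inner sum as coefficients of powers of (1 - t) / (1 - p t).

    w : ℕ → ℕ → ℕ → Carrier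
    w j k i = ι (+ ((j + i) C k)) * p ^ᴿ i

    -- The inner sum of the theorem for k = `d + 1` and n = `j + d`, written as a difference so that
    -- Pascal's rule for `w` becomes a recurrence.
    A : ℕ → ℕ → Carrier
    A j d = Δ d (w j (suc d))

    A-zero : ∀ d → A 0 d ≈ 0#
    A-zero d = trans (Δ-cong d λ i i≤d → trans (*-congʳ (trans
      (reflexive (≡.cong (λ x → ι (+ x)) (k>n⇒nCk≡0 (s≤s i≤d)))) 0-homo)) (zeroˡ _)) (Δ-0 d)

    w-pascal : ∀ j k i → w (suc j) (suc k) i ≈ w j k i +ᴿ w j (suc k) i
    w-pascal j k i = trans (*-congʳ (trans
      (reflexive (≡.cong (λ x → ι (+ x)) (≡.sym (nCk+nC[k+1]≡[n+1]C[k+1] (j + i) k)))) (+-homo _ _)))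
      (distribʳ _ _ _)

    w-suc : ∀ j k i → w j k (suc i) ≈ p * w (suc j) k i
    w-suc j k i = trans (*-congʳ (reflexive (≡.cong (λ x → ι (+ (x C k))) (ℕₚ.+-suc j i))))
      (solve 3 (λ x y z → x :* (y :* z) := y :* (x :* z)) refl _ _ _)

    -- Pascal's rule splits `w (suc j) (suc (suc d))` in two. The part with the same lower index
    -- gives `A j (suc d)`. For the other, one difference is opened, and by `w-suc` its shifted half
    -- is `p` times `w (suc j) (suc d)`.
    A-rec : ∀ j d → A (suc j) (suc d) ≈ p * A (suc j) d -ᴿ A j d +ᴿ A j (suc d)
    A-rec j d = trans (Δ-cong (suc d) λ i _ → w-pascal j (suc d) i) (trans (Δ-+ _ _ (suc d))
      (+-congʳ (+-congʳ (trans (Δ-cong d λ i _ → w-suc j (suc d) i) (Δ-* p _ d)))))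

    A-suc-zero : ∀ j → A (suc j) 0 ≈ 1# +ᴿ A j 0
    A-suc-zero j = trans (w-pascal j 0 0) (+-congʳ (trans (*-identityʳ _) 1-homo))

    -- `A` obeys the linear recurrence of `V`. The factor -q arises in the first column, where
    -- `V _ 0` is 1 and contributes p - 1 = -q, against the increment 1 in `A-suc-zero`.
    V≈-qA : ∀ j d → V j (suc d) ≈ -ᴿ (q * A j d)
    V≈-qA zero    d       = sym (trans (-‿cong (trans (*-congˡ (A-zero d)) (zeroʳ q))) -0#≈0#)
    V≈-qA (suc j) zero    = begin
      p * 1# +ᴿ V j 1 -ᴿ 1#
        ≈⟨ +-congʳ (+-cong (p* 1#) (V≈-qA j 0)) ⟩
      (1# -ᴿ q * 1#) +ᴿ -ᴿ (q * A j 0) -ᴿ 1#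
        ≈⟨ solve 3 (λ u q x → (u :- q :* u) :+ :- (q :* x) :- u := :- (q :* (u :+ x))) refl 1# q (A j 0) ⟩
      -ᴿ (q * (1# +ᴿ A j 0))
        ≈⟨ -‿cong (*-congˡ (sym (A-suc-zero j))) ⟩
      -ᴿ (q * A (suc j) 0) ∎
    V≈-qA (suc j) (suc d) = begin
      p * V (suc j) (suc d) +ᴿ V j (suc (suc d)) -ᴿ V j (suc d)
        ≈⟨ +-cong (+-cong (*-congˡ (V≈-qA (suc j) d)) (V≈-qA j (suc d))) (-‿cong (V≈-qA j d)) ⟩
      p * (-ᴿ (q * A (suc j) d)) +ᴿ -ᴿ (q * A j (suc d)) -ᴿ (-ᴿ (q * A j d))
        ≈⟨ solve 5 (λ p q x y z → p :* (:- (q :* x)) :+ :- (q :* y) :- (:- (q :* z))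
             := :- (q :* (p :* x :- z :+ y))) refl p q _ _ _ ⟩
      -ᴿ (q * (p * A (suc j) d -ᴿ A j d +ᴿ A j (suc d)))
        ≈⟨ -‿cong (*-congˡ (sym (A-rec j d))) ⟩
      -ᴿ (q * A (suc j) (suc d)) ∎

    -- By `H≈E` and `E-one` the entry `H (n + 2) 1` is the power of `p`. In its sum, `d = 0`
    -- contributes `B (n + 2) 1` itself, and `V≈-qA` turns all terms with positive `d` into `-S`.
    B-first : ∀ n → B (suc (suc n)) 1 ≈
      p ^ᴿ suc n +ᴿ q * anti (λ j d → B (suc j) 1 * A (suc (suc j)) d) n
    B-first n = begin
      B (suc (suc n)) 1
        ≈⟨ solve 2 (λ x y → x := (x :+ :- y) :+ y) refl _ _ ⟩
      (B (suc (suc n)) 1 -ᴿ S) +ᴿ S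
        ≈⟨ +-congʳ (+-cong (sym (*-identityʳ _)) (sym V-part)) ⟩
      anti (λ j d → B (suc j) 1 * V (suc (suc j)) d) (suc n) +ᴿ S
        ≈⟨ +-congʳ (trans (sym (H-suc (suc n) 0)) (trans (H≈E (suc (suc n)) 1) (E-one (suc n)))) ⟩
      p ^ᴿ suc n +ᴿ S ∎
      where
      S : Carrier
      S = q * anti (λ j d → B (suc j) 1 * A (suc (suc j)) d) n

      V-part : anti (λ j d → B (suc j) 1 * V (suc (suc j)) (suc d)) n ≈ -ᴿ S
      V-part = trans
        (anti-cong n λ j d _ → trans (*-congˡ (V≈-qA (suc (suc j)) d))
          (solve 3 (λ b q x → b :* (:- (q :* x)) := :- (q :* (b :* x))) refl _ q _))
        (trans (anti-neg _ n) (-‿cong (anti-* q _ n)))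

open ≡ using (refl; sym; trans; cong; cong₂)
open ℤ-Solver.+-*-Solver using (solve; _:=_; _:+_; _:*_; _:-_; con)

-- The commutative ring of polynomials.

module ℤ-Sums = RingWithIntegers ℤₚ.+-*-commutativeRing
  (-raw-almostCommutative⟶ (fromCommutativeRing ℤₚ.+-*-commutativeRing))
open ℤ-Sums using (anti; anti-cong; anti-sucˡ; anti-swap; anti-+; anti-*; anti-0)

-- The local functions of Defs cannot be named; unification recovers them here
-- as the metavariables `_`, once their arguments are abstracted to variables.
mutual
  ⊗-go : Poly → Poly → ℕ → ℕ → ℤ
  ⊗-go = _

  ⊗-go-unfold : ∀ p r i → (p ⊗ r) (suc i) ≡
    ⊗-go p r (suc i) i ℤ.+ p i *ℤ r (suc i ∸ i) ℤ.+ p (suc i) *ℤ r (i ∸ i)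
  ⊗-go-unfold p r i with suc i | ℤ._+_
  ... | _ | _ = refl

mutual
  ∑-go : ℕ → ℕ → (ℕ → Poly) → ℕ → Poly
  ∑-go = _

  ∑-go-unfold : ∀ lo hi f → ∑ lo hi f ≡ ∑-go lo hi f (suc hi ∸ lo)
  ∑-go-unfold lo hi f with suc hi ∸ lo
  ... | _ = refl

-- The second antidiagonal index goes to `p`, so that `conv p r (suc n)` unfolds to
-- `p 0 *ℤ r (suc n)` plus `conv (p ∘ suc) r n`. Inductions such as `conv-assoc` then run by
-- dropping the constant term of `p`, free of truncated subtraction.
conv : Poly → Poly → Poly
conv p r = anti (λ i j → p j *ℤ r i)

⊗-conv : ∀ p r → p ⊗ r ≈ₚ conv p r
⊗-conv p r i = trans (go i)
  (anti-cong i λ k j k+j≡i → cong (λ x → p j *ℤ r x)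
    (trans (cong (_∸ j) (sym k+j≡i)) (ℕₚ.m+n∸n≡m k j)))
  where
  go : ∀ n → ⊗-go p r i (suc n) ≡ anti (λ _ j → p j *ℤ r (i ∸ j)) n
  go zero    = ℤₚ.+-identityˡ _
  go (suc n) = trans (cong (ℤ._+ p (suc n) *ℤ r (i ∸ suc n)) (go n))
    (trans (ℤₚ.+-comm _ (p (suc n) *ℤ r (i ∸ suc n))) (sym (anti-sucˡ (λ _ j → p j *ℤ r (i ∸ j)) n)))

conv-cong : ∀ {p p′ r r′} → p ≈ₚ p′ → r ≈ₚ r′ → conv p r ≈ₚ conv p′ r′
conv-cong p≈p′ r≈r′ n = anti-cong n λ i j _ → cong₂ _*ℤ_ (p≈p′ j) (r≈r′ i)

conv-assoc : ∀ p r s → conv (conv p r) s ≈ₚ conv p (conv r s)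
conv-assoc p r s zero    = ℤₚ.*-assoc (p 0) (r 0) (s 0)
conv-assoc p r s (suc n) = begin
  p 0 *ℤ r 0 *ℤ s (suc n) ℤ.+ anti (λ i j → (p 0 *ℤ r (suc j) ℤ.+ conv (p ∘ suc) r j) *ℤ s i) n
    ≡⟨ cong (λ x → p 0 *ℤ r 0 *ℤ s (suc n) ℤ.+ x) (trans
         (anti-cong n λ i j _ → solve 4 (λ a b c d → (a :* b :+ c) :* d := a :* (b :* d) :+ c :* d) refl
           (p 0) (r (suc j)) (conv (p ∘ suc) r j) (s i))
         (trans (anti-+ (λ i j → p 0 *ℤ (r (suc j) *ℤ s i)) (λ i j → conv (p ∘ suc) r j *ℤ s i) n)
           (cong₂ ℤ._+_ (anti-* (p 0) (λ i j → r (suc j) *ℤ s i) n) (conv-assoc (p ∘ suc) r s n)))) ⟩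
  p 0 *ℤ r 0 *ℤ s (suc n) ℤ.+ (p 0 *ℤ conv (r ∘ suc) s n ℤ.+ conv (p ∘ suc) (conv r s) n)
    ≡⟨ solve 5 (λ a b c d e → a :* b :* c :+ (a :* d :+ e) := a :* (b :* c :+ d) :+ e) refl
         (p 0) (r 0) (s (suc n)) _ _ ⟩
  conv p (conv r s) (suc n) ∎
  where open ≡.≡-Reasoning

cst-⊗ : ∀ a p i → (cst a ⊗ p) i ≡ a *ℤ p i
cst-⊗ a p i = trans (⊗-conv (cst a) p i) (go i)
  where
  go : ∀ i → conv (cst a) p i ≡ a *ℤ p i
  go zero    = refl
  go (suc n) = trans (cong (λ x → a *ℤ p (suc n) ℤ.+ x) (anti-0 n)) (ℤₚ.+-identityʳ _)

⊗-cong : ∀ {p p′ r r′} → p ≈ₚ p′ → r ≈ₚ r′ → p ⊗ r ≈ₚ p′ ⊗ r′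
⊗-cong {p} {p′} {r} {r′} p≈p′ r≈r′ i =
  trans (⊗-conv p r i) (trans (conv-cong p≈p′ r≈r′ i) (sym (⊗-conv p′ r′ i)))

⊗-assoc : ∀ p r s → (p ⊗ r) ⊗ s ≈ₚ p ⊗ (r ⊗ s)
⊗-assoc p r s i = begin
  ((p ⊗ r) ⊗ s) i       ≡⟨ ⊗-conv (p ⊗ r) s i ⟩
  conv (p ⊗ r) s i      ≡⟨ conv-cong {r = s} (⊗-conv p r) (λ _ → refl) i ⟩
  conv (conv p r) s i   ≡⟨ conv-assoc p r s i ⟩
  conv p (conv r s) i   ≡⟨ conv-cong {p} (λ _ → refl) (⊗-conv r s) i ⟨
  conv p (r ⊗ s) i      ≡⟨ ⊗-conv p (r ⊗ s) i ⟨
  (p ⊗ (r ⊗ s)) i       ∎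
  where open ≡.≡-Reasoning

⊗-comm : ∀ p r → p ⊗ r ≈ₚ r ⊗ p
⊗-comm p r n = begin
  (p ⊗ r) n                      ≡⟨ ⊗-conv p r n ⟩
  anti (λ i j → p j *ℤ r i) n    ≡⟨ anti-swap (λ i j → p j *ℤ r i) n ⟩
  anti (λ i j → p i *ℤ r j) n    ≡⟨ anti-cong n (λ i j _ → ℤₚ.*-comm (p i) (r j)) ⟩
  conv r p n                     ≡⟨ ⊗-conv r p n ⟨
  (r ⊗ p) n                      ∎
  where open ≡.≡-Reasoning

⊗-distribˡ : ∀ p r s → p ⊗ (r ⊕ s) ≈ₚ (p ⊗ r) ⊕ (p ⊗ s)
⊗-distribˡ p r s n = begin
  (p ⊗ (r ⊕ s)) n
    ≡⟨ ⊗-conv p (r ⊕ s) n ⟩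
  anti (λ i j → p j *ℤ (r i ℤ.+ s i)) n
    ≡⟨ anti-cong n (λ i j _ → ℤₚ.*-distribˡ-+ (p j) (r i) (s i)) ⟩
  anti (λ i j → p j *ℤ r i ℤ.+ p j *ℤ s i) n
    ≡⟨ anti-+ (λ i j → p j *ℤ r i) (λ i j → p j *ℤ s i) n ⟩
  conv p r n ℤ.+ conv p s n
    ≡⟨ cong₂ ℤ._+_ (⊗-conv p r n) (⊗-conv p s n) ⟨
  (p ⊗ r) n ℤ.+ (p ⊗ s) n ∎
  where open ≡.≡-Reasoning

⊗-identityˡ : ∀ p → cst (+ 1) ⊗ p ≈ₚ p
⊗-identityˡ p i = trans (cst-⊗ (+ 1) p i) (ℤₚ.*-identityˡ (p i))

cst-0 : ∀ i → cst (+ 0) i ≡ + 0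
cst-0 zero    = refl
cst-0 (suc _) = refl

Poly-commutativeRing : CommutativeRing 0ℓ 0ℓ
Poly-commutativeRing = record
  { Carrier = Poly ; _≈_ = _≈ₚ_ ; _+_ = _⊕_ ; _*_ = _⊗_ ; -_ = negP ; 0# = cst (+ 0) ; 1# = cst (+ 1)
  ; isCommutativeRing = record
    { isRing = record
      { +-isAbelianGroup = record
        { isGroup = record
          { isMonoid = record
            { isSemigroup = record
              { isMagma = record
                { isEquivalence = record
                  { refl = λ _ → refl ; sym = λ e i → sym (e i) ; trans = λ e f i → trans (e i) (f i) }
                ; ∙-cong = λ e f i → cong₂ ℤ._+_ (e i) (f i)
                }
              ; assoc = λ p r s i → ℤₚ.+-assoc (p i) (r i) (s i)
              }
            ; identity = ⊕-identityˡ , λ p i → trans (ℤₚ.+-comm (p i) _) (⊕-identityˡ p i)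
            }
          ; inverse = (λ p i → trans (ℤₚ.+-inverseˡ (p i)) (sym (cst-0 i)))
                    , (λ p i → trans (ℤₚ.+-inverseʳ (p i)) (sym (cst-0 i)))
          ; ⁻¹-cong = λ e i → cong -_ (e i)
          }
        ; comm = λ p r i → ℤₚ.+-comm (p i) (r i)
        }
      ; *-cong = ⊗-cong
      ; *-assoc = ⊗-assoc
      ; *-identity = ⊗-identityˡ , λ p i → trans (⊗-comm p _ i) (⊗-identityˡ p i)
      ; distrib = ⊗-distribˡ , λ p r s i → trans (⊗-comm (r ⊕ s) p i)
          (trans (⊗-distribˡ p r s i) (cong₂ ℤ._+_ (⊗-comm p r i) (⊗-comm p s i)))
      }
    ; *-comm = ⊗-comm
    }
  }
  where
  ⊕-identityˡ : ∀ p → cst (+ 0) ⊕ p ≈ₚ p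
  ⊕-identityˡ p i = trans (cong (ℤ._+ p i) (cst-0 i)) (ℤₚ.+-identityˡ (p i))

cst-hom : CommutativeRing.rawRing ℤₚ.+-*-commutativeRing
  -Raw-AlmostCommutative⟶ fromCommutativeRing Poly-commutativeRing
cst-hom = record
  { ⟦_⟧    = cst
  ; +-homo = λ { _ _ zero → refl ; _ _ (suc _) → refl }
  ; *-homo = λ { a b zero → sym (cst-⊗ a (cst b) zero)
               ; a b (suc i) → sym (trans (cst-⊗ a (cst b) (suc i)) (ℤₚ.*-zeroʳ a)) }
  ; -‿homo = λ { _ zero → refl ; _ (suc _) → refl }
  ; 0-homo = λ _ → refl
  ; 1-homo = λ _ → refl
  }

module PolyRing = CommutativeRing Poly-commutativeRing
module PolySums = RingWithIntegers Poly-commutativeRing cst-hom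
open PolySums using (_^ᴿ_; sgn)
open PolySums.Inversion qP using (A; B; B-first)

qP-⊗-suc : ∀ p i → (qP ⊗ p) (suc i) ≡ p i
qP-⊗-suc p i = begin
  (qP ⊗ p) (suc i)                    ≡⟨ ⊗-conv qP p (suc i) ⟩
  + 0 ℤ.+ conv (qP ∘ suc) p i         ≡⟨ ℤₚ.+-identityˡ _ ⟩
  conv (qP ∘ suc) p i                 ≡⟨ conv-cong {r = p} qP∘suc (λ _ → refl) i ⟩
  conv (cst (+ 1)) p i                ≡⟨ ⊗-conv (cst (+ 1)) p i ⟨
  (cst (+ 1) ⊗ p) i                   ≡⟨ ⊗-identityˡ p i ⟩
  p i                                 ∎
  where
  open ≡.≡-Reasoning
  qP∘suc : qP ∘ suc ≈ₚ cst (+ 1)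
  qP∘suc zero    = refl
  qP∘suc (suc _) = refl

-- Narayana numbers as determinants of binomial coefficients.

binom : ℕ → ℕ → ℤ
binom n k = + (n C k)

-- The lower index is `k - 1`, with value 0 at `k = 0`, so that Pascal's rule and absorption hold
-- for every `k`.
binom⁻ : ℕ → ℕ → ℤ
binom⁻ n zero    = + 0
binom⁻ n (suc k) = binom n k

pascal : ∀ n k → binom (suc n) k ≡ binom⁻ n k ℤ.+ binom n k
pascal n zero    = refl
pascal n (suc k) = cong +_ (sym (nCk+nC[k+1]≡[n+1]C[k+1] n k))

-- Subtraction in ℤ keeps this valid for `k > n + 1`, where the factor is negative but both
-- binomials vanish. Induction on `n`, through Pascal's rule on each side.
absorption : ∀ n k → + k *ℤ binom n k ≡ (+ suc n ℤ.- + k) *ℤ binom⁻ n k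
absorption n       zero          = sym (ℤₚ.*-zeroʳ (+ suc n ℤ.- + 0))
absorption zero    (suc zero)    = refl
absorption zero    (suc (suc k)) = trans
  (ℤₚ.*-zeroʳ (+ suc (suc k)))
  (sym (ℤₚ.*-zeroʳ (+ 1 ℤ.- + suc (suc k))))
absorption (suc n) (suc k)       = begin
  + suc k *ℤ binom (suc n) (suc k)
    ≡⟨ cong (+ suc k *ℤ_) (pascal n (suc k)) ⟩
  + suc k *ℤ (b ℤ.+ binom n (suc k))
    ≡⟨ trans (ℤₚ.*-distribˡ-+ (+ suc k) b (binom n (suc k)))
         (cong (λ x → + suc k *ℤ b ℤ.+ x) (absorption n (suc k))) ⟩
  + suc k *ℤ b ℤ.+ (+ suc n ℤ.- + suc k) *ℤ b
    ≡⟨ solve 3 (λ n k b → (con (+ 1) :+ k) :* b :+ ((con (+ 1) :+ n) :- (con (+ 1) :+ k)) :* b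
         := k :* b :+ ((con (+ 1) :+ n) :- k) :* b) refl (+ n) (+ k) b ⟩
  + k *ℤ b ℤ.+ (+ suc n ℤ.- + k) *ℤ b
    ≡⟨ cong (ℤ._+ (+ suc n ℤ.- + k) *ℤ b) (absorption n k) ⟩
  (+ suc n ℤ.- + k) *ℤ binom⁻ n k ℤ.+ (+ suc n ℤ.- + k) *ℤ b
    ≡⟨ solve 4 (λ n k a b → ((con (+ 1) :+ n) :- k) :* a :+ ((con (+ 1) :+ n) :- k) :* b
         := (con (+ 1) :+ (con (+ 1) :+ n) :- (con (+ 1) :+ k)) :* (a :+ b)) refl (+ n) (+ k) (binom⁻ n k) b ⟩
  (+ suc (suc n) ℤ.- + suc k) *ℤ (binom⁻ n k ℤ.+ b)
    ≡⟨ cong ((+ suc (suc n) ℤ.- + suc k) *ℤ_) (sym (pascal n k)) ⟩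
  (+ suc (suc n) ℤ.- + suc k) *ℤ binom (suc n) k ∎
  where
  open ≡.≡-Reasoning
  b : ℤ
  b = binom n k

-- A Lindström–Gessel–Viennot determinant, counting pairs of non-crossing
-- lattice paths.
B-determinant : ∀ n r i →
  B (suc n) r i ≡ binom n i *ℤ binom⁻ n (i + r) ℤ.- binom⁻ n i *ℤ binom n (i + r)
B-determinant n zero i = trans (cst-0 i) (sym (trans
  (cong (λ x → binom n i *ℤ binom⁻ n x ℤ.- binom⁻ n i *ℤ binom n x) (ℕₚ.+-identityʳ i))
  (solve 2 (λ x y → x :* y :- y :* x := con (+ 0)) refl (binom n i) (binom⁻ n i))))
B-determinant zero (suc r) i = trans
  (cong₂ ℤ._+_ (cong (λ x → B 0 r i ℤ.+ x) (cong₂ ℤ._+_ (cst-0 i) (q0 i))) (q0 i))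
  (trans (ℤₚ.+-identityʳ _) (trans (ℤₚ.+-identityʳ _) (trans (base r i)
    (cong (λ x → binom 0 i *ℤ binom⁻ 0 x ℤ.- binom⁻ 0 i *ℤ binom 0 x) (sym (ℕₚ.+-suc i r))))))
  where
  q0 : ∀ i → (qP ⊗ cst (+ 0)) i ≡ + 0
  q0 zero    = refl
  q0 (suc i) = trans (qP-⊗-suc (cst (+ 0)) i) (cst-0 i)

  base : ∀ r i → B 0 r i ≡ binom 0 i *ℤ binom 0 (i + r) ℤ.- binom⁻ 0 i *ℤ binom 0 (suc (i + r))
  base zero    zero    = refl
  base zero    (suc i) = sym (cong (λ x → + 0 ℤ.- x) (ℤₚ.*-zeroʳ (binom 0 i)))
  base (suc r) zero    = refl
  base (suc r) (suc i) = sym (cong (λ x → + 0 ℤ.- x) (ℤₚ.*-zeroʳ (binom 0 i)))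
B-determinant (suc n) (suc r) zero = trans
  (cong₂ (λ x y → x ℤ.+ (y ℤ.+ + 0) ℤ.+ + 0) (B-determinant n r 0) (B-determinant n (suc r) 0))
  (trans (solve 4 (λ x y z w →
      (con (+ 1) :* x :- con (+ 0) :* y) :+ ((con (+ 1) :* y :- con (+ 0) :* z) :+ con (+ 0)) :+ con (+ 0)
      := con (+ 1) :* (x :+ y) :- con (+ 0) :* w) refl
      (binom⁻ n r) (binom n r) (binom n (suc r)) (binom (suc n) (suc r)))
    (cong (λ x → + 1 *ℤ x ℤ.- + 0 *ℤ binom (suc n) (suc r)) (sym (pascal n r))))
B-determinant (suc n) (suc r) (suc k) = begin
  B (suc n) r (suc k) ℤ.+ (B (suc n) (suc r) (suc k) ℤ.+ (qP ⊗ B (suc n) (suc r)) (suc k))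
    ℤ.+ (qP ⊗ B (suc n) (suc (suc r))) (suc k)
    ≡⟨ cong₂ ℤ._+_ (cong₂ ℤ._+_ (B-determinant n r (suc k)) (cong₂ ℤ._+_ (B-determinant n (suc r) (suc k))
         (trans (qP-⊗-suc (B (suc n) (suc r)) k) (B-determinant n (suc r) k))))
         (trans (qP-⊗-suc (B (suc n) (suc (suc r))) k) (B-determinant n (suc (suc r)) k)) ⟩
  det (suc k) (suc k + r) ℤ.+ (det (suc k) (suc k + suc r) ℤ.+ det k (k + suc r)) ℤ.+ det k (k + suc (suc r))
    ≡⟨ cong₂ (λ x y → det (suc k) (suc u) ℤ.+ (det (suc k) (suc x) ℤ.+ det k x) ℤ.+ det k y)
         (ℕₚ.+-suc k r) (trans (ℕₚ.+-suc k (suc r)) (cong suc (ℕₚ.+-suc k r))) ⟩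
  det (suc k) (suc u) ℤ.+ (det (suc k) (suc (suc u)) ℤ.+ det k (suc u)) ℤ.+ det k (suc (suc u))
    -- Pascal's rule writes each of the two columns of the determinant as a sum of two columns. By
    -- bilinearity four determinants result, one for each term in the recurrence of `B`.
    ≡⟨ solve 6 (λ α a b x y z →
         (b :* x :- a :* y) :+ ((b :* y :- a :* z) :+ (a :* x :- α :* y)) :+ (a :* y :- α :* z)
         := (a :+ b) :* (x :+ y) :- (α :+ a) :* (y :+ z)) refl
         (binom⁻ n k) (binom n k) (binom n (suc k)) (binom n u) (binom n (suc u)) (binom n (suc (suc u))) ⟩
  (binom n k ℤ.+ binom n (suc k)) *ℤ (binom n u ℤ.+ binom n (suc u))
    ℤ.- (binom⁻ n k ℤ.+ binom n k) *ℤ (binom n (suc u) ℤ.+ binom n (suc (suc u)))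
    ≡⟨ cong₂ ℤ._-_ (cong₂ _*ℤ_ (sym (pascal n (suc k))) (sym (pascal n (suc u))))
         (cong₂ _*ℤ_ (sym (pascal n k)) (sym (pascal n (suc (suc u))))) ⟩
  binom (suc n) (suc k) *ℤ binom (suc n) (suc u) ℤ.- binom (suc n) k *ℤ binom (suc n) (suc (suc u))
    ≡⟨ cong (λ x → binom (suc n) (suc k) *ℤ binom (suc n) x ℤ.- binom (suc n) k *ℤ binom (suc n) (suc x))
         (sym (ℕₚ.+-suc k r)) ⟩
  binom (suc n) (suc k) *ℤ binom⁻ (suc n) (suc k + suc r)
    ℤ.- binom⁻ (suc n) (suc k) *ℤ binom (suc n) (suc k + suc r) ∎
  where
  open ≡.≡-Reasoning
  u : ℕ
  u = k + r
  det : ℕ → ℕ → ℤ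
  det i s = binom n i *ℤ binom⁻ n s ℤ.- binom⁻ n i *ℤ binom n s

-- One equation over ℤ yields both the exactness of the division and the non-negativity of `x`.
quotient-unique : ∀ x m n → + suc n *ℤ x ≡ + m → x ≡ + (m / suc n)
quotient-unique (+ x) m n eq = cong +_ (sym (trans (cong (_/ suc n) m≡x*[1+n]) (m*n/n≡m x (suc n))))
  where
  m≡x*[1+n] : m ≡ x ℕ.* suc n
  m≡x*[1+n] = trans (ℤₚ.+-injective (trans (sym eq) (sym (ℤₚ.pos-* (suc n) x)))) (ℕₚ.*-comm (suc n) x)
quotient-unique -[1+ x ] m n ()

Narayana≈B : ∀ n → Narayana (suc n) ≈ₚ B (suc n) 1
Narayana≈B n i = sym (quotient-unique (B (suc n) 1 i) _ n (begin
  + suc n *ℤ B (suc n) 1 i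
    ≡⟨ cong (+ suc n *ℤ_) (trans (B-determinant n 1 i)
         (cong (λ x → b *ℤ binom⁻ n x ℤ.- a *ℤ binom n x) (ℕₚ.+-comm i 1))) ⟩
  + suc n *ℤ (b *ℤ b ℤ.- a *ℤ c)
    -- The two added brackets are the absorption relations at `i` and `i + 1`, hence zero. The
    -- multipliers `b + c` and `a + b` are those that make this a polynomial identity.
    ≡⟨ solve 5 (λ n i a b c → (con (+ 1) :+ n) :* (b :* b :- a :* c)
         := (a :+ b) :* (b :+ c)
            :+ (b :+ c) :* (i :* b :- ((con (+ 1) :+ n) :- i) :* a)
            :- (a :+ b) :* ((con (+ 1) :+ i) :* c :- ((con (+ 1) :+ n) :- (con (+ 1) :+ i)) :* b))
         refl (+ n) (+ i) a b c ⟩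
  (a ℤ.+ b) *ℤ (b ℤ.+ c)
    ℤ.+ (b ℤ.+ c) *ℤ (+ i *ℤ b ℤ.- (+ suc n ℤ.- + i) *ℤ a)
    ℤ.- (a ℤ.+ b) *ℤ (+ suc i *ℤ c ℤ.- (+ suc n ℤ.- + suc i) *ℤ b)
    ≡⟨ cong₂ (λ x y → (a ℤ.+ b) *ℤ (b ℤ.+ c) ℤ.+ (b ℤ.+ c) *ℤ x ℤ.- (a ℤ.+ b) *ℤ y)
         (ℤₚ.i≡j⇒i-j≡0 (absorption n i)) (ℤₚ.i≡j⇒i-j≡0 (absorption n (suc i))) ⟩
  (a ℤ.+ b) *ℤ (b ℤ.+ c) ℤ.+ (b ℤ.+ c) *ℤ + 0 ℤ.- (a ℤ.+ b) *ℤ + 0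
    ≡⟨ solve 3 (λ x y z → x :+ y :* con (+ 0) :- z :* con (+ 0) := x) refl _ (b ℤ.+ c) (a ℤ.+ b) ⟩
  (a ℤ.+ b) *ℤ (b ℤ.+ c)
    ≡⟨ cong₂ _*ℤ_ (sym (pascal n i)) (sym (pascal n (suc i))) ⟩
  binom (suc n) i *ℤ binom (suc n) (suc i)
    ≡⟨ ℤₚ.pos-* (suc n C i) (suc n C suc i) ⟨
  + ((suc n C i) ℕ.* (suc n C suc i)) ∎))
  where
  open ≡.≡-Reasoning
  a b c : ℤ
  a = binom⁻ n i
  b = binom n i
  c = binom n (suc i)

-- Translation of the sums in the theorem.

^ₚ≈^ᴿ : ∀ p n → p ^ₚ n ≈ₚ p ^ᴿ n
^ₚ≈^ᴿ p zero    = PolyRing.refl {p ^ₚ 0}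
^ₚ≈^ᴿ p (suc n) = PolyRing.*-congˡ {p} (^ₚ≈^ᴿ p n)

∑-go-anti : ∀ lo hi f n → ∑-go lo hi f (suc n) ≈ₚ PolySums.anti (λ _ j → f (lo + j)) n
∑-go-anti lo hi f zero    = PolyRing.+-identityˡ (f (lo + 0))
∑-go-anti lo hi f (suc n) = PolyRing.trans
  (PolyRing.+-congʳ {f (lo + suc n)} (∑-go-anti lo hi f n))
  (PolyRing.trans (PolyRing.+-comm _ (f (lo + suc n)))
    (PolyRing.sym (PolySums.anti-sucˡ (λ _ j → f (lo + j)) n)))

inner : ℕ → ℕ → Poly
inner n k = ∑ 0 (k ∸ 1) (λ m →
  cst ((- (+ 1)) ^ m *ℤ + ((k ∸ 1) C m) *ℤ + ((n ∸ m) C k)) ⊗ (cst (+ 1) ⊖ qP) ^ₚ (k ∸ m ∸ 1))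

-- Reading the sum from the other end, `i = d - m`, turns the last binomial and the power into
-- `w j (suc d) i`. The signed binomials that remain form a `d`-th difference by `Δ-binomial`.
inner≈A : ∀ j d → inner (j + d) (suc d) ≈ₚ A j d
inner≈A j d = PolyRing.trans (∑-go-anti 0 d _ d)
  (PolyRing.trans (PolySums.anti-cong d term) (PolySums.Δ-binomial _ d))
  where
  term : ∀ i m → i + m ≡ d →
    cst (sgn m *ℤ + (d C m) *ℤ + ((j + d ∸ m) C suc d)) ⊗ (cst (+ 1) ⊖ qP) ^ₚ (suc d ∸ m ∸ 1) ≈ₚ
    cst (sgn m *ℤ + (d C m)) ⊗ (cst (+ ((j + i) C suc d)) ⊗ (cst (+ 1) ⊖ qP) ^ᴿ i)
  term i m refl
    -- With `d = i + m` every truncated subtraction is exact: the upper index becomes `j + i` and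
    -- the exponent `i`.
    rewrite sym (ℕₚ.+-assoc j i m) | ℕₚ.m+n∸n≡m (j + i) m | ℕₚ.m+n∸n≡m (suc i) m
    = PolyRing.trans
        (PolyRing.*-cong (_-Raw-AlmostCommutative⟶_.*-homo cst-hom x y) (^ₚ≈^ᴿ (cst (+ 1) ⊖ qP) i))
        (PolyRing.*-assoc (cst x) (cst y) _)
    where
    x y : ℤ
    x = sgn m *ℤ + ((i + m) C m)
    y = + ((j + i) C suc (i + m))

theorem3 : ∀ (n : ℕ) → 1 ≤ n →
    Narayana n ≈ₚ
    ((cst (+ 1) ⊖ qP) ^ₚ (n ∸ 1)
    ⊕ qP ⊗ ∑ 1 (n ∸ 1) (λ k → Narayana (n ∸ k) ⊗
    ∑ 0 (k ∸ 1) (λ m →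
    cst ((- (+ 1)) ^ m *ℤ + ((k ∸ 1) C m) *ℤ + ((n ∸ m) C k))
    ⊗ (cst (+ 1) ⊖ qP) ^ₚ (k ∸ m ∸ 1))))
-- The outer sum is empty here. `B 1 1` unfolds to 1 plus multiples of zero, which collapse to the
-- single term `qP ⊗ cst (+ 0)` of the right side.
theorem3 (suc zero)    _ = PolyRing.trans (Narayana≈B 0)
  (PolyRing.trans (PolyRing.+-congʳ {qP ⊗ cst (+ 0)} (PolyRing.+-congˡ {cst (+ 1)}
    (PolyRing.trans (PolyRing.+-identityˡ (qP ⊗ cst (+ 0))) (PolyRing.zeroʳ qP))))
    (PolyRing.+-congʳ {qP ⊗ cst (+ 0)} (PolyRing.+-identityʳ (cst (+ 1)))))
theorem3 (suc (suc n)) _ = PolyRing.trans (Narayana≈B (suc n)) (PolyRing.trans (B-first n)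
  (PolyRing.sym (PolyRing.+-cong (^ₚ≈^ᴿ (cst (+ 1) ⊖ qP) (suc n)) (PolyRing.*-congˡ {qP}
    (PolyRing.trans (∑-go-anti 1 (suc n) summand n) (PolySums.anti-cong n term))))))
  where
  summand : ℕ → Poly
  summand k = Narayana (suc (suc n) ∸ k) ⊗ inner (suc (suc n)) k

  -- The outer index is k = `d + 1`. The Narayana index `n + 2 - k` is then `j + 1`, while the first
  -- argument of `A` is `n + 2 - d`, that is `j + 2`.
  term : ∀ j d → j + d ≡ n → summand (suc d) ≈ₚ B (suc j) 1 ⊗ A (suc (suc j)) d
  term j d refl rewrite ℕₚ.m+n∸n≡m (suc j) d = PolyRing.*-cong (Narayana≈B j) (inner≈A (suc (suc j)) d)
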